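{- Let $R$ be one of the chain rings $\mathbb{G}_4=\mathbb{Z}_4[X]/(X^2+X+1)$, $\mathbb{S}_4=\mathbb{F}_4[X]/(X^2)$, $\mathbb{T}_4=\mathbb{F}_4[X;a\mapsto a^2]/(X^2)$. Then there exist projective arcs with parameters $(166,11)$ and $(186,12)$ in $\mathrm{PHG}(2,R)$.
   Context: $\mathbb{F}_4[X;a\mapsto a^2]$ denotes the skew polynomial ring with commutation rule $Xa=a^2X$. For a finite chain ring $R$ of length $2$ with residue field $\mathbb{F}_q$, the projective Hjelmslev plane $\mathrm{PHG}(2,R)$ is the incidence structure whose points are the free rank-$1$ submodules of the right module $R_R^3$, whose lines are the free rank-$2$ submodules of $R_R^3$, with incidence given by inclusion. A projective $(k,n)$-arc is a set of $k$ points meeting every line in at most $n$ points. -}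

module Defs where

open import Algebra.Bundles using (Ring; CommutativeRing; AbelianGroup)
open import Algebra.Module.Bundles using (RightModule)
open import Algebra.Morphism.Structures using (module RingMorphisms)
import Algebra.Construct.DirectProduct as Product
import Algebra.Properties.CommutativeSemigroup as CommutativeSemigroupProperties
import Algebra.Solver.Ring.NaturalCoefficients.Default as SemiringSolver
import Algebra.Definitions.RawMonoid as Summation
import Algebra.Module.Construct.DirectProduct as ModuleProduct
import Algebra.Module.Construct.TensorUnit as TensorUnit
import Algebra.Morphism.Construct.Identity as Identity
open import Data.Bool.Base using (true; false)
open import Data.Bool.Properties using (xor-∧-commutativeRing)
open import Data.Fin.Base using (Fin; toℕ)
open import Data.Fin.Patterns using (0F; 1F)
open import Data.Fin.Properties using (all?; _≟_)
open import Data.Fin.Subset using (Subset; ∣_∣; _∈_)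
open import Data.Nat.Base as ℕ using (ℕ; _≤_)
open import Data.Nat.DivMod using (_mod_)
open import Data.Product.Base using (Σ-syntax; ∃-syntax; _×_; _,_)
open import Data.Vec.Functional using (Vector)
open import Function.Base using (id)
open import Function.Definitions using (Injective)
open import Level using (Level; 0ℓ; _⊔_; suc)
open import Relation.Binary.Bundles using (Setoid)
open import Relation.Binary.Definitions using (_Respects_)
open import Relation.Binary.PropositionalEquality.Core as ≡ using (_≡_; cong; cong₂)
open import Relation.Binary.PropositionalEquality.Properties using (isEquivalence)
open import Relation.Nullary.Decidable using (from-yes)
open import Relation.Unary using (Pred; _⊆_)

-- Quotients of (skew) polynomial rings by a monic polynomial of degree 2.
-- Every residue class has a unique representative a + bX, encoded as the
-- pair (a , b); addition is componentwise.

-- A[X]/(X² - uX - v), with products reduced by X² = uX + v.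
module ModQuadratic {c ℓ} (A : CommutativeRing c ℓ) (u v : CommutativeRing.Carrier A) where

  open CommutativeRing A
  open SemiringSolver commutativeSemiring using (solve; _:=_; _:+_; _:*_)

  private
    dropˡ : ∀ w {x y} b → x ≈ y → x + w * (0# * b) ≈ y
    dropˡ w b p = trans (+-cong p (trans (*-congˡ (zeroˡ b)) (zeroʳ w))) (+-identityʳ _)

    dropʳ : ∀ w {x y} b → x ≈ y → x + w * (b * 0#) ≈ y
    dropʳ w b p = trans (+-cong p (trans (*-congˡ (zeroʳ b)) (zeroʳ w))) (+-identityʳ _)

    assoc₀ : ∀ u v a b c d e f →
      (a * c + v * (b * d)) * e + v * ((a * d + b * c + u * (b * d)) * f) ≈
      a * (c * e + v * (d * f)) + v * (b * (c * f + d * e + u * (d * f)))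
    assoc₀ = solve 8 (λ u v a b c d e f →
      (a :* c :+ v :* (b :* d)) :* e :+ v :* ((a :* d :+ b :* c :+ u :* (b :* d)) :* f) :=
      a :* (c :* e :+ v :* (d :* f)) :+ v :* (b :* (c :* f :+ d :* e :+ u :* (d :* f)))) refl

    assoc₁ : ∀ u v a b c d e f →
      (a * c + v * (b * d)) * f + (a * d + b * c + u * (b * d)) * e + u * ((a * d + b * c + u * (b * d)) * f) ≈
      a * (c * f + d * e + u * (d * f)) + b * (c * e + v * (d * f)) + u * (b * (c * f + d * e + u * (d * f)))
    assoc₁ = solve 8 (λ u v a b c d e f →
      (a :* c :+ v :* (b :* d)) :* f :+ (a :* d :+ b :* c :+ u :* (b :* d)) :* e :+ u :* ((a :* d :+ b :* c :+ u :* (b :* d)) :* f) :=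
      a :* (c :* f :+ d :* e :+ u :* (d :* f)) :+ b :* (c :* e :+ v :* (d :* f)) :+ u :* (b :* (c :* f :+ d :* e :+ u :* (d :* f)))) refl

    distribˡ₀ : ∀ v a b c d e f →
      a * (c + e) + v * (b * (d + f)) ≈
      (a * c + v * (b * d)) + (a * e + v * (b * f))
    distribˡ₀ = solve 7 (λ v a b c d e f →
      a :* (c :+ e) :+ v :* (b :* (d :+ f)) :=
      (a :* c :+ v :* (b :* d)) :+ (a :* e :+ v :* (b :* f))) refl

    distribˡ₁ : ∀ u a b c d e f →
      a * (d + f) + b * (c + e) + u * (b * (d + f)) ≈
      (a * d + b * c + u * (b * d)) + (a * f + b * e + u * (b * f))
    distribˡ₁ = solve 7 (λ u a b c d e f →
      a :* (d :+ f) :+ b :* (c :+ e) :+ u :* (b :* (d :+ f)) :=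
      (a :* d :+ b :* c :+ u :* (b :* d)) :+ (a :* f :+ b :* e :+ u :* (b :* f))) refl

    distribʳ₀ : ∀ v a b c d e f →
      (c + e) * a + v * ((d + f) * b) ≈
      (c * a + v * (d * b)) + (e * a + v * (f * b))
    distribʳ₀ = solve 7 (λ v a b c d e f →
      (c :+ e) :* a :+ v :* ((d :+ f) :* b) :=
      (c :* a :+ v :* (d :* b)) :+ (e :* a :+ v :* (f :* b))) refl

    distribʳ₁ : ∀ u a b c d e f →
      (c + e) * b + (d + f) * a + u * ((d + f) * b) ≈
      (c * b + d * a + u * (d * b)) + (e * b + f * a + u * (f * b))
    distribʳ₁ = solve 7 (λ u a b c d e f →
      (c :+ e) :* b :+ (d :+ f) :* a :+ u :* ((d :+ f) :* b) :=
      (c :* b :+ d :* a :+ u :* (d :* b)) :+ (e :* b :+ f :* a :+ u :* (f :* b))) refl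

    comm₀ : ∀ v a b c d →
      a * c + v * (b * d) ≈
      c * a + v * (d * b)
    comm₀ = solve 5 (λ v a b c d →
      a :* c :+ v :* (b :* d) :=
      c :* a :+ v :* (d :* b)) refl

    comm₁ : ∀ u a b c d →
      a * d + b * c + u * (b * d) ≈
      c * b + d * a + u * (d * b)
    comm₁ = solve 5 (λ u a b c d →
      a :* d :+ b :* c :+ u :* (b :* d) :=
      c :* b :+ d :* a :+ u :* (d :* b)) refl

  quotient : CommutativeRing c ℓ
  quotient = record
    { _*_ = λ (a , b) (c , d) → (a * c + v * (b * d)) , (a * d + b * c + u * (b * d))
    ; 1#  = 1# , 0#
    ; isCommutativeRing = record
      { isRing = record
        { +-isAbelianGroup = AbelianGroup.isAbelianGroup
            (Product.abelianGroup +-abelianGroup +-abelianGroup)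
        ; *-cong = λ (p , q) (r , s) →
              +-cong (*-cong p r) (*-congˡ (*-cong q s))
            , +-cong (+-cong (*-cong p s) (*-cong q r)) (*-congˡ (*-cong q s))
        ; *-assoc = λ (a , b) (c , d) (e , f) → assoc₀ u v a b c d e f , assoc₁ u v a b c d e f
        ; *-identity =
            (λ (a , b) → dropˡ v b (*-identityˡ a)
                       , dropˡ u b (trans (+-cong (*-identityˡ b) (zeroˡ a)) (+-identityʳ b)))
          , (λ (a , b) → dropʳ v b (*-identityʳ a)
                       , dropʳ u b (trans (+-cong (zeroʳ a) (*-identityʳ b)) (+-identityˡ b)))
        ; distrib =
            (λ (a , b) (c , d) (e , f) → distribˡ₀ v a b c d e f , distribˡ₁ u a b c d e f)
          , (λ (a , b) (c , d) (e , f) → distribʳ₀ v a b c d e f , distribʳ₁ u a b c d e f)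
        }
      ; *-comm = λ (a , b) (c , d) → comm₀ v a b c d , comm₁ u a b c d
      }
    }

_[X]/⟨X²+X+1⟩ : ∀ {c ℓ} → CommutativeRing c ℓ → CommutativeRing c ℓ
A [X]/⟨X²+X+1⟩ = ModQuadratic.quotient A (- 1#) (- 1#)
  where open CommutativeRing A using (-_; 1#)

-- A[X;σ]/(X²), where Xa = σ(a)X, so that
-- (a + bX)(c + dX) = ac + (ad + bσ(c))X.
module SkewModX² {c ℓ} (A : CommutativeRing c ℓ)
  (σ : CommutativeRing.Carrier A → CommutativeRing.Carrier A)
  (isHom : RingMorphisms.IsRingHomomorphism (CommutativeRing.rawRing A) (CommutativeRing.rawRing A) σ) where

  open CommutativeRing A
  open SemiringSolver commutativeSemiring using (solve; _:=_; _:+_; _:*_)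
  open RingMorphisms.IsRingHomomorphism isHom
    using (⟦⟧-cong; +-homo; *-homo; 1#-homo)

  private
    assoc₁ : ∀ a b c d f σc σe →
      (a * c) * f + (a * d + b * σc) * σe ≈
      a * (c * f + d * σe) + b * (σc * σe)
    assoc₁ = solve 7 (λ a b c d f σc σe →
      (a :* c) :* f :+ (a :* d :+ b :* σc) :* σe :=
      a :* (c :* f :+ d :* σe) :+ b :* (σc :* σe)) refl

    distribˡ₁ : ∀ a b d f σc σe →
      a * (d + f) + b * (σc + σe) ≈
      (a * d + b * σc) + (a * f + b * σe)
    distribˡ₁ = solve 6 (λ a b d f σc σe →
      a :* (d :+ f) :+ b :* (σc :+ σe) :=
      (a :* d :+ b :* σc) :+ (a :* f :+ b :* σe)) refl

    distribʳ₁ : ∀ b c d e f σa →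
      (c + e) * b + (d + f) * σa ≈
      (c * b + d * σa) + (e * b + f * σa)
    distribʳ₁ = solve 6 (λ b c d e f σa →
      (c :+ e) :* b :+ (d :+ f) :* σa :=
      (c :* b :+ d :* σa) :+ (e :* b :+ f :* σa)) refl

  quotient : Ring c ℓ
  quotient = record
    { _*_ = λ (a , b) (c , d) → (a * c) , (a * d + b * σ c)
    ; 1#  = 1# , 0#
    ; isRing = record
      { +-isAbelianGroup = AbelianGroup.isAbelianGroup
          (Product.abelianGroup +-abelianGroup +-abelianGroup)
      ; *-cong = λ (p , q) (r , s) →
          *-cong p r , +-cong (*-cong p s) (*-cong q (⟦⟧-cong r))
      ; *-assoc = λ (a , b) (c , d) (e , f) →
          *-assoc a c e
        , trans (assoc₁ a b c d f (σ c) (σ e))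
            (+-congˡ (*-congˡ (sym (*-homo c e))))
      ; *-identity =
          (λ (a , b) → *-identityˡ a , trans (+-cong (*-identityˡ b) (zeroˡ (σ a))) (+-identityʳ b))
        , (λ (a , b) → *-identityʳ a , trans (+-cong (zeroʳ a) (trans (*-congˡ 1#-homo) (*-identityʳ b))) (+-identityˡ b))
      ; distrib =
          (λ (a , b) (c , d) (e , f) →
              distribˡ a c e
            , trans (+-congˡ (*-congˡ (+-homo c e))) (distribˡ₁ a b d f (σ c) (σ e)))
        , (λ (a , b) (c , d) (e , f) →
              distribʳ a c e , distribʳ₁ b c d e f (σ a))
      }
    }

𝔽₂ : CommutativeRing 0ℓ 0ℓ
𝔽₂ = xor-∧-commutativeRing

ℤ₄ : CommutativeRing 0ℓ 0ℓ
ℤ₄ = record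
  { Carrier = Fin 4
  ; _≈_ = _≡_
  ; _+_ = _+_
  ; _*_ = _*_
  ; -_  = -_
  ; 0#  = 0F
  ; 1#  = 1F
  ; isCommutativeRing = record
    { isRing = record
      { +-isAbelianGroup = record
        { isGroup = record
          { isMonoid = record
            { isSemigroup = record
              { isMagma = record { isEquivalence = isEquivalence ; ∙-cong = cong₂ _+_ }
              ; assoc = from-yes (all? λ x → all? λ y → all? λ z → ((x + y) + z) ≟ (x + (y + z)))
              }
            ; identity = from-yes (all? λ x → (0F + x) ≟ x) , from-yes (all? λ x → (x + 0F) ≟ x)
            }
          ; inverse = from-yes (all? λ x → ((- x) + x) ≟ 0F) , from-yes (all? λ x → (x + (- x)) ≟ 0F)
          ; ⁻¹-cong = cong -_
          }
        ; comm = from-yes (all? λ x → all? λ y → (x + y) ≟ (y + x))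
        }
      ; *-cong = cong₂ _*_
      ; *-assoc = from-yes (all? λ x → all? λ y → all? λ z → ((x * y) * z) ≟ (x * (y * z)))
      ; *-identity = from-yes (all? λ x → (1F * x) ≟ x) , from-yes (all? λ x → (x * 1F) ≟ x)
      ; distrib =
          from-yes (all? λ x → all? λ y → all? λ z → (x * (y + z)) ≟ ((x * y) + (x * z)))
        , from-yes (all? λ x → all? λ y → all? λ z → ((y + z) * x) ≟ ((y * x) + (z * x)))
      }
    ; *-comm = from-yes (all? λ x → all? λ y → (x * y) ≟ (y * x))
    }
  }
  where
  _+_ _*_ : Fin 4 → Fin 4 → Fin 4
  x + y = (toℕ x ℕ.+ toℕ y) mod 4
  x * y = (toℕ x ℕ.* toℕ y) mod 4
  -_ : Fin 4 → Fin 4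
  - x = (4 ℕ.∸ toℕ x) mod 4

𝔽₄ : CommutativeRing 0ℓ 0ℓ
𝔽₄ = 𝔽₂ [X]/⟨X²+X+1⟩

module 𝔽₄ = CommutativeRing 𝔽₄

frobenius : 𝔽₄.Carrier → 𝔽₄.Carrier
frobenius a = a 𝔽₄.* a

frobenius-isRingHomomorphism :
  RingMorphisms.IsRingHomomorphism 𝔽₄.rawRing 𝔽₄.rawRing frobenius
frobenius-isRingHomomorphism = record
  { isSemiringHomomorphism = record
    { isNearSemiringHomomorphism = record
      { +-isMonoidHomomorphism = record
        { isMagmaHomomorphism = record
          { isRelHomomorphism = record { cong = λ p → 𝔽₄.*-cong p p }
          ; homo = +-homo
          }
        ; ε-homo = ≡.refl , ≡.refl
        }
      ; *-homo = *-homo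
      }
    ; 1#-homo = ≡.refl , ≡.refl
    }
  ; -‿homo = λ _ → ≡.refl , ≡.refl
  }
  where
  +-homo : ∀ x y → frobenius (x 𝔽₄.+ y) 𝔽₄.≈ (frobenius x 𝔽₄.+ frobenius y)
  +-homo (false , false) (false , false) = ≡.refl , ≡.refl
  +-homo (false , false) (false , true ) = ≡.refl , ≡.refl
  +-homo (false , false) (true  , false) = ≡.refl , ≡.refl
  +-homo (false , false) (true  , true ) = ≡.refl , ≡.refl
  +-homo (false , true ) (false , false) = ≡.refl , ≡.refl
  +-homo (false , true ) (false , true ) = ≡.refl , ≡.refl
  +-homo (false , true ) (true  , false) = ≡.refl , ≡.refl
  +-homo (false , true ) (true  , true ) = ≡.refl , ≡.refl
  +-homo (true  , false) (false , false) = ≡.refl , ≡.refl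
  +-homo (true  , false) (false , true ) = ≡.refl , ≡.refl
  +-homo (true  , false) (true  , false) = ≡.refl , ≡.refl
  +-homo (true  , false) (true  , true ) = ≡.refl , ≡.refl
  +-homo (true  , true ) (false , false) = ≡.refl , ≡.refl
  +-homo (true  , true ) (false , true ) = ≡.refl , ≡.refl
  +-homo (true  , true ) (true  , false) = ≡.refl , ≡.refl
  +-homo (true  , true ) (true  , true ) = ≡.refl , ≡.refl

  *-homo : ∀ x y → frobenius (x 𝔽₄.* y) 𝔽₄.≈ (frobenius x 𝔽₄.* frobenius y)
  *-homo x y = interchange x y x y
    where
    open CommutativeSemigroupProperties 𝔽₄.*-commutativeSemigroup using (interchange)

𝔾₄ : Ring 0ℓ 0ℓ
𝔾₄ = CommutativeRing.ring (ℤ₄ [X]/⟨X²+X+1⟩)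

𝕊₄ : Ring 0ℓ 0ℓ
𝕊₄ = SkewModX².quotient 𝔽₄ id (Identity.isRingHomomorphism 𝔽₄.rawRing 𝔽₄.refl)

𝕋₄ : Ring 0ℓ 0ℓ
𝕋₄ = SkewModX².quotient 𝔽₄ frobenius frobenius-isRingHomomorphism

module _ {r ℓr m ℓm : Level} {R : Ring r ℓr} (M : RightModule R m ℓm) where
  open Ring R using (Carrier; _≈_; 0#)
  open RightModule M

  record Submodule (p : Level) : Set (r ⊔ m ⊔ ℓm ⊔ suc p) where
    field
      Member     : Pred Carrierᴹ p
      resp       : Member Respects _≈ᴹ_
      0ᴹ-closed  : Member 0ᴹ
      +ᴹ-closed  : ∀ {x y} → Member x → Member y → Member (x +ᴹ y)
      *ᵣ-closed  : ∀ {x} → Member x → ∀ a → Member (x *ᵣ a)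

  linearCombination : ∀ {k} → Vector Carrierᴹ k → Vector Carrier k → Carrierᴹ
  linearCombination b a = Summation.sum +ᴹ-rawMonoid (λ i → b i *ᵣ a i)

  record IsBasis {p} (U : Submodule p) {k} (b : Vector Carrierᴹ k) : Set (r ⊔ ℓr ⊔ m ⊔ ℓm ⊔ p) where
    open Submodule U
    field
      members     : ∀ i → Member (b i)
      independent : ∀ a → linearCombination b a ≈ᴹ 0ᴹ → ∀ i → a i ≈ 0#
      spanning    : ∀ {x} → Member x → ∃[ a ] x ≈ᴹ linearCombination b a

  FreeOfRank : ∀ {p} → ℕ → Submodule p → Set (r ⊔ ℓr ⊔ m ⊔ ℓm ⊔ p)
  FreeOfRank k U = Σ[ b ∈ Vector Carrierᴹ k ] IsBasis U b

record IncidenceStructure (p ℓ l i : Level) : Set (suc (p ⊔ ℓ ⊔ l ⊔ i)) where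
  field
    Points : Setoid p ℓ
    Line   : Set l
  open Setoid Points public using () renaming (Carrier to Point; _≈_ to _≈ₚ_)
  field
    _I_ : Point → Line → Set i

-- R³ as R ⊕ (R ⊕ R).
cube : ∀ {c ℓ} (R : Ring c ℓ) → RightModule R c ℓ
cube R = ModuleProduct.rightModule R¹ (ModuleProduct.rightModule R¹ R¹)
  where R¹ = TensorUnit.rightModule {R = R}

-- Submodules are extensional: two points are equal when they have the same
-- members.  At level c ⊔ ℓ membership predicates include all spans.
PHG₂ : ∀ {c ℓ} → Ring c ℓ → IncidenceStructure (suc (c ⊔ ℓ)) (c ⊔ ℓ) (suc (c ⊔ ℓ)) (c ⊔ ℓ)
PHG₂ {c} {ℓ} R = record
  { Points = record
    { Carrier = Free 1
    ; _≈_ = λ P Q → (P ⊑ Q) × (Q ⊑ P)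
    ; isEquivalence = record
      { refl  = id , id
      ; sym   = λ (f , g) → g , f
      ; trans = λ (f , g) (h , k) → (λ z → h (f z)) , (λ z → g (k z))
      }
    }
  ; Line = Free 2
  ; _I_  = _⊑_
  }
  where
  Free : ℕ → Set (suc (c ⊔ ℓ))
  Free k = Σ[ U ∈ Submodule (cube R) (c ⊔ ℓ) ] FreeOfRank (cube R) k U

  _⊑_ : ∀ {j k} → Free j → Free k → Set (c ⊔ ℓ)
  (U , _) ⊑ (V , _) = Submodule.Member U ⊆ Submodule.Member V

module _ {p ℓ l i : Level} (𝓘 : IncidenceStructure p ℓ l i) where
  open IncidenceStructure 𝓘

  -- The k-set of points is listed without repetition by K; "at most n points
  -- on a line" bounds every set of indices whose points lie on that line.
  record IsProjectiveArc (k n : ℕ) (K : Fin k → Point) : Set (p ⊔ ℓ ⊔ l ⊔ i) where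
    field
      distinct : Injective _≡_ _≈ₚ_ K
      atMost   : ∀ (L : Line) (s : Subset k) → (∀ {j} → j ∈ s → K j I L) → ∣ s ∣ ≤ n

  ProjectiveArc : ℕ → ℕ → Set (p ⊔ ℓ ⊔ l ⊔ i)
  ProjectiveArc k n = Σ[ K ∈ (Fin k → Point) ] IsProjectiveArc k n K

{-# OPTIONS --safe #-}
module Submission where

-- A basis vector of a line has a unit coordinate, since otherwise it would be
-- killed by a generator θ of the radical, and so has the second basis vector
-- reduced modulo the first.  Gaussian elimination therefore puts every line in
-- the kernel of one of 336 reduced row vectors, and it remains to exhibit point
-- sets and to count their points in these kernels.  The sets were found by
-- simulated annealing among the unions of orbits of a collineation of order 5
-- with a single fixed point (note 166 ≡ 186 ≡ 1 mod 5).

open import Algebra.Bundles using (Ring)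
open import Algebra.Module.Bundles using (RightModule)
import Algebra.Properties.CommutativeSemigroup as CommutativeSemigroupProperties
import Algebra.Properties.Ring as RingProperties
import Data.Bool.Properties as Bool
open import Data.Empty using (⊥-elim)
open import Data.Fin.Base using (Fin; zero; suc)
open import Data.Fin.Patterns using (0F; 1F; 2F)
import Data.Fin.Properties as Fin
open import Data.Fin.Properties using (all?; any?; suc-injective; *↔×; 2↔Bool)
open import Data.Fin.Subset using (Subset; ∣_∣; _∈_; inside; outside)
open import Data.List.Base using (List; []; _∷_; length; lookup; filter; map)
open import Data.List.Membership.Propositional.Properties using (∈-lookup)
import Data.List.Relation.Unary.All as All
open import Data.List.Relation.Unary.All using (All)
open import Data.List.Relation.Unary.AllPairs using (AllPairs; _∷_; allPairs?)
open import Data.Nat.Base using (ℕ; _≤_; z≤n; s≤s; _/_)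
open import Data.Nat.DivMod using (_mod_)
open import Data.Nat.Properties using (_≤?_; m≤n⇒m≤1+n; ≤-trans)
open import Data.Product.Base using (_×_; _,_; ∃-syntax; proj₁; proj₂)
open import Data.Product.Function.NonDependent.Propositional using (_×-↔_)
open import Data.Product.Relation.Binary.Pointwise.NonDependent using (×-decidable)
open import Data.Sum.Base using (_⊎_; inj₁; inj₂; map₁)
open import Data.Unit.Polymorphic.Base using (⊤)
open import Data.Vec.Base using ([]; _∷_; here; there)
open import Data.Vec.Functional using (Vector)
open import Function.Base using (_∘_)
open import Function.Bundles using (_↔_; Inverse)
open import Function.Properties.Inverse using (↔-trans)
open import Level using (0ℓ; _⊔_)
open import Relation.Binary.Core using (Rel)
open import Relation.Binary.Definitions using (Decidable)
open import Relation.Binary.PropositionalEquality.Core as ≡ using (_≡_)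
import Relation.Binary.Reasoning.Setoid as SetoidReasoning
open import Relation.Nullary.Decidable using (Dec; yes; no; ¬?; _×-dec_; _⊎-dec_; _→-dec_; from-yes)
open import Relation.Nullary.Negation using (¬_)
import Relation.Unary as Unary
open import Relation.Unary using (Pred)
open import Defs

-- Counting and distinctness along a list.

-- The arc condition ranges over all subsets of indices. This bounds each of them by one count along
-- the list, which can be evaluated.
∣s∣≤∣filter∣ : ∀ {a p} {A : Set a} {P : Pred A p} (P? : Unary.Decidable P) (xs : List A)
  (s : Subset (length xs)) → (∀ {j} → j ∈ s → P (lookup xs j)) → ∣ s ∣ ≤ length (filter P? xs)
∣s∣≤∣filter∣ P? []       []            s⊆P = z≤n
∣s∣≤∣filter∣ P? (x ∷ xs) (inside ∷ s)  s⊆P with P? x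
... | yes _  = s≤s (∣s∣≤∣filter∣ P? xs s (s⊆P ∘ there))
... | no ¬Px = ⊥-elim (¬Px (s⊆P here))
∣s∣≤∣filter∣ P? (x ∷ xs) (outside ∷ s) s⊆P with P? x
... | yes _ = m≤n⇒m≤1+n (∣s∣≤∣filter∣ P? xs s (s⊆P ∘ there))
... | no _  = ∣s∣≤∣filter∣ P? xs s (s⊆P ∘ there)

-- `AllPairs` relates an earlier entry to a later one only, and `_≁_` need not be symmetric. So a
-- contradiction has to be available for either order of `i` and `j`.
allPairs⇒lookup-injective : ∀ {a ℓ} {A : Set a} {_≁_ : Rel A ℓ} {xs : List A} → AllPairs _≁_ xs →
  ∀ i j → (lookup xs i ≁ lookup xs j → i ≡ j) → (lookup xs j ≁ lookup xs i → i ≡ j) → i ≡ j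
allPairs⇒lookup-injective (_ ∷ _)     zero    zero    _ _ = ≡.refl
allPairs⇒lookup-injective (x≁xs ∷ _)  zero    (suc j) f _ = f (All.lookup x≁xs (∈-lookup j))
allPairs⇒lookup-injective (x≁xs ∷ _)  (suc i) zero    _ g = g (All.lookup x≁xs (∈-lookup i))
allPairs⇒lookup-injective (_ ∷ xs≁xs) (suc i) (suc j) f g = ≡.cong suc
  (allPairs⇒lookup-injective xs≁xs i j (suc-injective ∘ f) (suc-injective ∘ g))

-- Row vectors as linear forms on `R³`.

module Plane {c ℓ} (R : Ring c ℓ) where

  open Ring R
  open RightModule (cube R)
    using ( Carrierᴹ; _≈ᴹ_; _+ᴹ_; 0ᴹ; _*ᵣ_; ≈ᴹ-refl; ≈ᴹ-sym; ≈ᴹ-trans; +ᴹ-cong; +ᴹ-identityˡ; +ᴹ-identityʳ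
          ; *ᵣ-congˡ; *ᵣ-congʳ; *ᵣ-assoc; *ᵣ-distribˡ; *ᵣ-zeroʳ; *ᵣ-identityʳ )
  open RingProperties R using (-‿distribˡ-*; -‿distribʳ-*)
  open CommutativeSemigroupProperties +-commutativeSemigroup using (interchange)
  open SetoidReasoning setoid

  infix 8 _·_
  infixr 9 _*ₗ_

  _*ₗ_ : Carrier → Carrierᴹ → Carrierᴹ
  a *ₗ (h₁ , h₂ , h₃) = a * h₁ , a * h₂ , a * h₃

  -- Row times column, which is right linear in the column even when R is not commutative.
  _·_ : Carrierᴹ → Carrierᴹ → Carrier
  (h₁ , h₂ , h₃) · (x , y , z) = h₁ * x + (h₂ * y + h₃ * z)

  ·-congˡ : ∀ h {v w} → v ≈ᴹ w → h · v ≈ h · w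
  ·-congˡ h (p , q , r) = +-cong (*-congˡ p) (+-cong (*-congˡ q) (*-congˡ r))

  ·-congʳ : ∀ {g h} v → g ≈ᴹ h → g · v ≈ h · v
  ·-congʳ v (p , q , r) = +-cong (*-congʳ p) (+-cong (*-congʳ q) (*-congʳ r))

  ·-*ₗ : ∀ a h v → (a *ₗ h) · v ≈ a * h · v
  ·-*ₗ a (h₁ , h₂ , h₃) (x , y , z) = begin
    a * h₁ * x + (a * h₂ * y + a * h₃ * z)
      ≈⟨ +-cong (*-assoc a h₁ x) (+-cong (*-assoc a h₂ y) (*-assoc a h₃ z)) ⟩
    a * (h₁ * x) + (a * (h₂ * y) + a * (h₃ * z))
      ≈⟨ +-congˡ (distribˡ a _ _) ⟨
    a * (h₁ * x) + a * (h₂ * y + h₃ * z)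
      ≈⟨ distribˡ a _ _ ⟨
    a * (h₁ * x + (h₂ * y + h₃ * z)) ∎

  ·-0ᴹ : ∀ h → h · 0ᴹ ≈ 0#
  ·-0ᴹ (h₁ , h₂ , h₃) = begin
    h₁ * 0# + (h₂ * 0# + h₃ * 0#)  ≈⟨ +-cong (zeroʳ h₁) (+-cong (zeroʳ h₂) (zeroʳ h₃)) ⟩
    0# + (0# + 0#)                 ≈⟨ trans (+-identityˡ _) (+-identityˡ _) ⟩
    0#                             ∎

  ·-+ᴹ : ∀ h v w → h · (v +ᴹ w) ≈ h · v + h · w
  ·-+ᴹ (h₁ , h₂ , h₃) (x , y , z) (x′ , y′ , z′) = begin
    h₁ * (x + x′) + (h₂ * (y + y′) + h₃ * (z + z′))
      ≈⟨ +-cong (distribˡ h₁ x x′) (+-cong (distribˡ h₂ y y′) (distribˡ h₃ z z′)) ⟩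
    (h₁ * x + h₁ * x′) + ((h₂ * y + h₂ * y′) + (h₃ * z + h₃ * z′))
      ≈⟨ +-congˡ (interchange _ _ _ _) ⟩
    (h₁ * x + h₁ * x′) + ((h₂ * y + h₃ * z) + (h₂ * y′ + h₃ * z′))
      ≈⟨ interchange _ _ _ _ ⟩
    (h₁ * x + (h₂ * y + h₃ * z)) + (h₁ * x′ + (h₂ * y′ + h₃ * z′)) ∎

  ·-*ᵣ : ∀ h v a → h · (v *ᵣ a) ≈ h · v * a
  ·-*ᵣ (h₁ , h₂ , h₃) (x , y , z) a = begin
    h₁ * (x * a) + (h₂ * (y * a) + h₃ * (z * a))
      ≈⟨ +-cong (*-assoc h₁ x a) (+-cong (*-assoc h₂ y a) (*-assoc h₃ z a)) ⟨
    h₁ * x * a + (h₂ * y * a + h₃ * z * a)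
      ≈⟨ +-congˡ (distribʳ a _ _) ⟨
    h₁ * x * a + (h₂ * y + h₃ * z) * a
      ≈⟨ distribʳ a _ _ ⟨
    (h₁ * x + (h₂ * y + h₃ * z)) * a ∎

  Annihilates : Carrierᴹ → Carrierᴹ → Carrierᴹ → Set ℓ
  Annihilates h v w = h · v ≈ 0# × h · w ≈ 0#

  annihilates-combination : ∀ {k} h (b : Vector Carrierᴹ k) → (∀ i → h · b i ≈ 0#) →
    ∀ a → h · linearCombination (cube R) b a ≈ 0#
  annihilates-combination {ℕ.zero}  h b hb a = ·-0ᴹ h
  annihilates-combination {ℕ.suc k} h b hb a = begin
    h · (b 0F *ᵣ a 0F +ᴹ rest)     ≈⟨ ·-+ᴹ h _ _ ⟩
    h · (b 0F *ᵣ a 0F) + h · rest  ≈⟨ +-cong (·-*ᵣ h (b 0F) (a 0F))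
                                        (annihilates-combination h (b ∘ suc) (hb ∘ suc) (a ∘ suc)) ⟩
    h · b 0F * a 0F + 0#           ≈⟨ +-identityʳ _ ⟩
    h · b 0F * a 0F                ≈⟨ *-congʳ (hb 0F) ⟩
    0# * a 0F                      ≈⟨ zeroˡ _ ⟩
    0#                             ∎
    where rest = linearCombination (cube R) (b ∘ suc) (a ∘ suc)

  -- Elimination: every line lies in the kernel of a monic row.

  monic : Fin 3 → Carrier → Carrier → Carrierᴹ
  monic 0F α β = 1# , α , β
  monic 1F α β = α , 1# , β
  monic 2F α β = α , β , 1#

  -- Both equations are used: `u * x` to solve for an entry of a row on the left, `x * u` to clear a
  -- coordinate of a column on the right.
  Unit : Carrier → Set (c ⊔ ℓ)
  Unit x = ∃[ u ] x * u ≈ 1# × u * x ≈ 1#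

  cancel : ∀ {u x} → u * x ≈ 1# → ∀ s → - (s * u) * x + s ≈ 0#
  cancel {u} {x} ux≈1 s = begin
    - (s * u) * x + s    ≈⟨ +-congʳ (-‿distribˡ-* (s * u) x) ⟨
    - (s * u * x) + s    ≈⟨ +-congʳ (-‿cong (*-assoc s u x)) ⟩
    - (s * (u * x)) + s  ≈⟨ +-congʳ (-‿cong (trans (*-congˡ ux≈1) (*-identityʳ s))) ⟩
    - s + s              ≈⟨ -‿inverseˡ s ⟩
    0#                   ∎

  -- θ is to be a generator of the radical of a chain ring of length 2, so that
  -- the non-units are exactly the elements annihilating θ.
  Reduced : Carrier → Fin 3 → Carrier → Carrier → Set ℓ
  Reduced θ 0F α β = α * θ ≈ 0# × β * θ ≈ 0#
  Reduced θ 1F α β = β * θ ≈ 0#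
  Reduced θ 2F α β = ⊤

  module _ (θ : Carrier) (unit? : ∀ x → Unit x ⊎ x * θ ≈ 0#) where

    -- The factors `1#` are kept so that either equation is an instance of the hypothesis of
    -- `annihilates`.
    Kernel₂ : Carrier → Carrier → Set (c ⊔ ℓ)
    Kernel₂ y z = (∃[ β ] 1# * y + β * z ≈ 0#) ⊎ (∃[ α ] α * y + 1# * z ≈ 0#)

    -- A unit entry can absorb whatever the other entry contributes with coefficient 1. Without a
    -- unit entry, θ kills both from the right.
    kernel₂ : ∀ y z → Kernel₂ y z ⊎ (y * θ ≈ 0# × z * θ ≈ 0#)
    kernel₂ y z with unit? y | unit? z
    ... | inj₁ (v , _ , vy≈1) | _                   =
      inj₁ (inj₂ (- (z * v) , trans (+-congˡ (*-identityˡ z)) (cancel vy≈1 z)))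
    ... | inj₂ _              | inj₁ (w , _ , wz≈1) =
      inj₁ (inj₁ (- (y * w) , trans (trans (+-congʳ (*-identityˡ y)) (+-comm _ _)) (cancel wz≈1 y)))
    ... | inj₂ yθ≈0           | inj₂ zθ≈0           = inj₂ (yθ≈0 , zθ≈0)

    -- With θ nonzero this is a nontrivial relation, so it cannot hold between the two vectors of a
    -- basis.
    Dependent : Carrierᴹ → Carrierᴹ → Set (c ⊔ ℓ)
    Dependent v w = ∃[ a ] (v *ᵣ a) +ᴹ (w *ᵣ θ) ≈ᴹ 0ᴹ

    -- Eliminating the first coordinate of w with the unit x leaves a pair
    -- (y′ + yn , z′ + zn), to which kernel₂ applies.
    module Eliminate (x y z x′ y′ z′ : Carrier) (x-unit : Unit x) where

      private
        u = proj₁ x-unit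
        n = - (u * x′)

        x′+xn≈0 : x′ + x * n ≈ 0#
        x′+xn≈0 = begin
          x′ + x * - (u * x′)  ≈⟨ +-congˡ (-‿distribʳ-* x (u * x′)) ⟨
          x′ - x * (u * x′)    ≈⟨ +-congˡ (-‿cong (*-assoc x u x′)) ⟨
          x′ - x * u * x′      ≈⟨ +-congˡ (-‿cong (*-congʳ (proj₁ (proj₂ x-unit)))) ⟩
          x′ - 1# * x′         ≈⟨ +-congˡ (-‿cong (*-identityˡ x′)) ⟩
          x′ - x′              ≈⟨ -‿inverseʳ x′ ⟩
          0#                   ∎

        -- Write h for the row `(- ((p * y + q * z) * u) , p , q)`. It kills v, so h · w = h · (w +
        -- vn), and w + vn has first coordinate 0; only the pairing of `(p , q)` with the remaining
        -- pair is left.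
        kills-w : ∀ p q → p * (y′ + y * n) + q * (z′ + z * n) ≈ 0# →
          - ((p * y + q * z) * u) * x′ + (p * y′ + q * z′) ≈ 0#
        kills-w p q eq = begin
          - (s * u) * x′ + t                   ≈⟨ +-congʳ (-‿distribˡ-* (s * u) x′) ⟨
          - (s * u * x′) + t                   ≈⟨ +-congʳ (-‿cong (*-assoc s u x′)) ⟩
          - (s * (u * x′)) + t                 ≈⟨ +-congʳ (-‿distribʳ-* s (u * x′)) ⟩
          s * n + t                            ≈⟨ +-comm _ _ ⟩
          t + s * n                            ≈⟨ +-congˡ (distribʳ n (p * y) (q * z)) ⟩
          t + (p * y * n + q * z * n)          ≈⟨ +-congˡ (+-cong (*-assoc p y n) (*-assoc q z n)) ⟩
          t + (p * (y * n) + q * (z * n))      ≈⟨ interchange _ _ _ _ ⟩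
          (p * y′ + p * (y * n)) + (q * z′ + q * (z * n))
            ≈⟨ +-cong (distribˡ p y′ (y * n)) (distribˡ q z′ (z * n)) ⟨
          p * (y′ + y * n) + q * (z′ + z * n)  ≈⟨ eq ⟩
          0#                                   ∎
          where
          s = p * y + q * z
          t = p * y′ + q * z′

        clear : ∀ a a′ → (a′ + a * n) * θ ≈ 0# → a * (n * θ) + a′ * θ ≈ 0#
        clear a a′ eq = begin
          a * (n * θ) + a′ * θ  ≈⟨ +-congʳ (*-assoc a n θ) ⟨
          a * n * θ + a′ * θ    ≈⟨ +-comm _ _ ⟩
          a′ * θ + a * n * θ    ≈⟨ distribʳ θ a′ (a * n) ⟨
          (a′ + a * n) * θ      ≈⟨ eq ⟩
          0#                    ∎

        v = x , y , z
        w = x′ , y′ , z′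

        annihilates : ∀ p q → p * (y′ + y * n) + q * (z′ + z * n) ≈ 0# →
          Annihilates (- ((p * y + q * z) * u) , p , q) v w
        annihilates p q eq = cancel (proj₂ (proj₂ x-unit)) _ , kills-w p q eq

      eliminate : (∃[ α ] ∃[ β ] (Annihilates (α , 1# , β) v w ⊎ Annihilates (α , β , 1#) v w)) ⊎
        Dependent v w
      eliminate with kernel₂ (y′ + y * n) (z′ + z * n)
      ... | inj₁ (inj₁ (β , eq)) = inj₁ (_ , _ , inj₁ (annihilates 1# β eq))
      ... | inj₁ (inj₂ (α , eq)) = inj₁ (_ , _ , inj₂ (annihilates α 1# eq))
      -- Here θ kills all of w + vn, and (w + vn)θ = v(nθ) + wθ, whence the witness `n * θ`.
      ... | inj₂ (yθ≈0 , zθ≈0)   = inj₂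
        (n * θ , clear x x′ (trans (*-congʳ x′+xn≈0) (zeroˡ θ)) , clear y y′ yθ≈0 , clear z z′ zθ≈0)

    private
      swap₁₂ : ∀ {a b c} → a + (b + c) ≈ 0# → b + (a + c) ≈ 0#
      swap₁₂ {a} {b} {c} = trans (trans (sym (+-assoc b a c)) (trans (+-congʳ (+-comm b a)) (+-assoc a b c)))

      rotate : ∀ {a b c} → a + (b + c) ≈ 0# → b + (c + a) ≈ 0#
      rotate {a} {b} {c} = trans (trans (sym (+-assoc b c a)) (+-comm (b + c) a))

    -- The pivot is the first unit coordinate of `v`. It is moved to the front for `eliminate`, and
    -- `swap₁₂` and `rotate` restore the order of the summands afterwards. If `v` has no unit
    -- coordinate, θ kills it.
    annihilator : ∀ v w → (∃[ i ] ∃[ α ] ∃[ β ] Annihilates (monic i α β) v w) ⊎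
      (v *ᵣ θ ≈ᴹ 0ᴹ) ⊎ Dependent v w
    annihilator (x , y , z) (x′ , y′ , z′) with unit? x | unit? y | unit? z
    ... | inj₁ x-unit | _ | _ with Eliminate.eliminate x y z x′ y′ z′ x-unit
    ...   | inj₁ (_ , _ , inj₁ eqs) = inj₁ (1F , _ , _ , eqs)
    ...   | inj₁ (_ , _ , inj₂ eqs) = inj₁ (2F , _ , _ , eqs)
    ...   | inj₂ dep = inj₂ (inj₂ dep)
    annihilator (x , y , z) (x′ , y′ , z′)
        | inj₂ _ | inj₁ y-unit | _ with Eliminate.eliminate y x z y′ x′ z′ y-unit
    ...   | inj₁ (_ , _ , inj₁ (p , q)) = inj₁ (0F , _ , _ , swap₁₂ p , swap₁₂ q)
    ...   | inj₁ (_ , _ , inj₂ (p , q)) = inj₁ (2F , _ , _ , swap₁₂ p , swap₁₂ q)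
    ...   | inj₂ (a , p , q , r) = inj₂ (inj₂ (a , q , p , r))
    annihilator (x , y , z) (x′ , y′ , z′)
        | inj₂ _ | inj₂ _ | inj₁ z-unit with Eliminate.eliminate z x y z′ x′ y′ z-unit
    ...   | inj₁ (_ , _ , inj₁ (p , q)) = inj₁ (0F , _ , _ , rotate p , rotate q)
    ...   | inj₁ (_ , _ , inj₂ (p , q)) = inj₁ (1F , _ , _ , rotate p , rotate q)
    ...   | inj₂ (a , p , q , r) = inj₂ (inj₂ (a , q , r , p))
    annihilator (x , y , z) (x′ , y′ , z′)
        | inj₂ xθ≈0 | inj₂ yθ≈0 | inj₂ zθ≈0 = inj₂ (inj₁ (xθ≈0 , yθ≈0 , zθ≈0))

    -- Reduced rows.

    -- A left multiple of a row vanishes wherever the row does, so the row may be scaled to have 1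
    -- at its last unit coordinate. The entries after it are then non-units, and stay so under left
    -- multiplication. With 16 ring elements, 4 of them killing θ, this leaves 16 + 64 + 256 = 336
    -- of the 768 monic rows.
    reduce : ∀ i α β → ∃[ j ] ∃[ γ ] ∃[ δ ] Reduced θ j γ δ × ∃[ u ] u *ₗ monic i α β ≈ᴹ monic j γ δ
    reduce 0F α β with unit? β | unit? α
    ... | inj₁ (u , _ , uβ≈1) | _                   = 2F , u , u * α , _ , u , *-identityʳ u , refl , uβ≈1
    ... | inj₂ βθ≈0           | inj₁ (u , _ , uα≈1) =
      1F , u , u * β , trans (*-assoc u β θ) (trans (*-congˡ βθ≈0) (zeroʳ u)) , u , *-identityʳ u , uα≈1 , refl
    ... | inj₂ βθ≈0           | inj₂ αθ≈0           =
      0F , α , β , (αθ≈0 , βθ≈0) , 1# , *-identityˡ 1# , *-identityˡ α , *-identityˡ β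
    reduce 1F α β with unit? β
    ... | inj₁ (u , _ , uβ≈1) = 2F , u * α , u , _ , u , refl , *-identityʳ u , uβ≈1
    ... | inj₂ βθ≈0           = 1F , α , β , βθ≈0 , 1# , *-identityˡ α , *-identityˡ 1# , *-identityˡ β
    reduce 2F α β = 2F , α , β , _ , 1# , *-identityˡ α , *-identityˡ β , *-identityˡ 1#

    module _ (θ≉0 : ¬ θ ≈ 0#) {p} {U : Submodule (cube R) p} where

      open Submodule U using (Member)

      -- Independence of the basis excludes the two degenerate outcomes of `annihilator`: they are
      -- relations with coefficients `(θ , 0#)` and `(a , θ)`, where θ is nonzero. A row killing
      -- both basis vectors kills their span.
      line⊆monic-kernel : FreeOfRank (cube R) 2 U →
        ∃[ i ] ∃[ α ] ∃[ β ] (∀ {v} → Member v → monic i α β · v ≈ 0#)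
      line⊆monic-kernel (b , isBasis) with annihilator (b 0F) (b 1F)
      ... | inj₁ (i , α , β , hb₀≈0 , hb₁≈0) = i , α , β , λ v∈U →
              let a , v≈ba = IsBasis.spanning isBasis v∈U in
              trans (·-congˡ (monic i α β) v≈ba)
                (annihilates-combination (monic i α β) b (λ { 0F → hb₀≈0 ; 1F → hb₁≈0 }) a)
      ... | inj₂ (inj₁ b₀θ≈0)     =
              ⊥-elim (θ≉0 (IsBasis.independent isBasis (λ { 0F → θ ; 1F → 0# }) b₀θ+b₁0≈0 0F))
        where
        b₀θ+b₁0≈0 = ≈ᴹ-trans (+ᴹ-cong b₀θ≈0 (≈ᴹ-trans (+ᴹ-identityʳ _) (*ᵣ-zeroʳ (b 1F)))) (+ᴹ-identityˡ 0ᴹ)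
      ... | inj₂ (inj₂ (a , dep)) =
              ⊥-elim (θ≉0 (IsBasis.independent isBasis (λ { 0F → a ; 1F → θ }) b₀a+b₁θ≈0 1F))
        where
        b₀a+b₁θ≈0 = ≈ᴹ-trans (+ᴹ-cong ≈ᴹ-refl (+ᴹ-identityʳ _)) dep

      line⊆reduced-kernel : FreeOfRank (cube R) 2 U →
        ∃[ i ] ∃[ α ] ∃[ β ] Reduced θ i α β × (∀ {v} → Member v → monic i α β · v ≈ 0#)
      line⊆reduced-kernel free =
        let i , α , β , U⊆ker          = line⊆monic-kernel free
            j , γ , δ , red , u , uh≈g = reduce i α β
        in j , γ , δ , red , λ {v} v∈U → begin
          monic j γ δ · v         ≈⟨ ·-congʳ v uh≈g ⟨
          (u *ₗ monic i α β) · v  ≈⟨ ·-*ₗ u (monic i α β) v ⟩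
          u * monic i α β · v     ≈⟨ *-congˡ (U⊆ker v∈U) ⟩
          u * 0#                  ≈⟨ zeroʳ u ⟩
          0#                      ∎

  -- Points spanned by vectors with a coordinate 1.

  coordinate : Fin 3 → Carrierᴹ → Carrier
  coordinate 0F (x , _ , _) = x
  coordinate 1F (_ , y , _) = y
  coordinate 2F (_ , _ , z) = z

  coordinate-cong : ∀ i {v w} → v ≈ᴹ w → coordinate i v ≈ coordinate i w
  coordinate-cong 0F (p , _ , _) = p
  coordinate-cong 1F (_ , q , _) = q
  coordinate-cong 2F (_ , _ , r) = r

  coordinate-*ᵣ : ∀ i v a → coordinate i (v *ᵣ a) ≈ coordinate i v * a
  coordinate-*ᵣ 0F v a = refl
  coordinate-*ᵣ 1F v a = refl
  coordinate-*ᵣ 2F v a = refl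

  coordinate-0ᴹ : ∀ i → coordinate i 0ᴹ ≈ 0#
  coordinate-0ᴹ 0F = refl
  coordinate-0ᴹ 1F = refl
  coordinate-0ᴹ 2F = refl

  Normalised : Carrierᴹ → Set ℓ
  Normalised v = ∃[ i ] coordinate i v ≈ 1#

  -- The coordinate at which `v` is 1 reads off the scalar. This gives both the freeness of `span v`
  -- and a test for membership in it.
  scalar-unique : ∀ {v w a} i → coordinate i v ≈ 1# → w ≈ᴹ v *ᵣ a → coordinate i w ≈ a
  scalar-unique {v} {w} {a} i vᵢ≈1 w≈va = begin
    coordinate i w         ≈⟨ coordinate-cong i w≈va ⟩
    coordinate i (v *ᵣ a)  ≈⟨ coordinate-*ᵣ i v a ⟩
    coordinate i v * a     ≈⟨ *-congʳ vᵢ≈1 ⟩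
    1# * a                 ≈⟨ *-identityˡ a ⟩
    a                      ∎

  span : Carrierᴹ → Submodule (cube R) (c ⊔ ℓ)
  span v = record
    { Member    = λ w → ∃[ a ] w ≈ᴹ v *ᵣ a
    ; resp      = λ { w≈w′ (a , w≈va) → a , ≈ᴹ-trans (≈ᴹ-sym w≈w′) w≈va }
    ; 0ᴹ-closed = 0# , ≈ᴹ-sym (*ᵣ-zeroʳ v)
    ; +ᴹ-closed = λ { (a , p) (b , q) → a + b , ≈ᴹ-trans (+ᴹ-cong p q) (≈ᴹ-sym (*ᵣ-distribˡ v a b)) }
    ; *ᵣ-closed = λ { (a , p) b → a * b , ≈ᴹ-trans (*ᵣ-congʳ p) (*ᵣ-assoc v a b) }
    }

  v∈span : ∀ v → Submodule.Member (span v) v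
  v∈span v = 1# , ≈ᴹ-sym (*ᵣ-identityʳ v)

  open IncidenceStructure (PHG₂ R) using (Point)

  point : ∀ {v} → Normalised v → Point
  point {v} (i , vᵢ≈1) = span v , (λ _ → v) , record
    { members     = λ _ → v∈span v
    ; independent = λ { a va≈0 0F → trans
        (sym (scalar-unique i vᵢ≈1 (≈ᴹ-sym (≈ᴹ-trans (≈ᴹ-sym (+ᴹ-identityʳ _)) va≈0))))
        (coordinate-0ᴹ i) }
    ; spanning    = λ { (a , w≈va) → (λ _ → a) , ≈ᴹ-trans w≈va (≈ᴹ-sym (+ᴹ-identityʳ _)) }
    }

  -- Non-membership of `w` in the span of `v`, stated without a quantifier over scalars: where `v`
  -- has coordinate 1, the only candidate scalar is that coordinate of `w`. It is vacuous for a `v`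
  -- with no such coordinate, so it is used together with `Normalised v`.
  Separated : Rel Carrierᴹ ℓ
  Separated v w = ∀ i → coordinate i v ≈ 1# → ¬ w ≈ᴹ v *ᵣ coordinate i w

  separated⇒∉span : ∀ {v w} → Normalised v → Separated v w → ¬ Submodule.Member (span v) w
  separated⇒∉span {v} (i , vᵢ≈1) sep (a , w≈va) =
    sep i vᵢ≈1 (≈ᴹ-trans w≈va (*ᵣ-congˡ {v} (sym (scalar-unique i vᵢ≈1 w≈va))))

-- Decidable certificates for arcs over a ring of 16 elements.

module Search {c ℓ} (R : Ring c ℓ) (enumeration : Fin 16 ↔ Ring.Carrier R)
  (_≟_ : Decidable (Ring._≈_ R)) (θ : Ring.Carrier R) where

  open Ring R
  open Plane R
  open RightModule (cube R) using (Carrierᴹ; _≈ᴹ_; _*ᵣ_)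
  open Inverse enumeration using ()
    renaming (to to element; from to index; strictlyInverseˡ to element-index)

  UnitOrRadical : Fin 16 → Set ℓ
  UnitOrRadical i =
    (∃[ j ] element i * element j ≈ 1# × element j * element i ≈ 1#) ⊎ element i * θ ≈ 0#

  unitOrRadical? : Unary.Decidable UnitOrRadical
  unitOrRadical? i =
    any? (λ j → ((element i * element j) ≟ 1#) ×-dec ((element j * element i) ≟ 1#)) ⊎-dec
    ((element i * θ) ≟ 0#)

  unit? : (∀ i → UnitOrRadical i) → ∀ x → Unit x ⊎ x * θ ≈ 0#
  unit? f x = ≡.subst (λ y → Unit y ⊎ y * θ ≈ 0#) (element-index x)
    (map₁ (λ (j , p , q) → element j , p , q) (f (index x)))

  _≟ᴹ_ : Decidable _≈ᴹ_
  (x , y , z) ≟ᴹ (x′ , y′ , z′) = (x ≟ x′) ×-dec ((y ≟ y′) ×-dec (z ≟ z′))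

  normalised? : Unary.Decidable Normalised
  normalised? v = any? λ i → coordinate i v ≟ 1#

  separated? : Decidable Separated
  separated? v w = all? λ i → (coordinate i v ≟ 1#) →-dec ¬? (w ≟ᴹ (v *ᵣ coordinate i w))

  reduced? : ∀ i α β → Dec (Reduced θ i α β)
  reduced? 0F α β = ((α * θ) ≟ 0#) ×-dec ((β * θ) ≟ 0#)
  reduced? 1F α β = (β * θ) ≟ 0#
  reduced? 2F α β = yes _

  kernelSize : Carrierᴹ → List Carrierᴹ → ℕ
  kernelSize h vs = length (filter (λ v → (h · v) ≟ 0#) vs)

  -- The premise `Reduced` confines the counts to the reduced rows.
  AtMost : ℕ → List Carrierᴹ → Fin 3 → Carrier → Carrier → Set ℓ
  AtMost n vs i α β = Reduced θ i α β → kernelSize (monic i α β) vs ≤ n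

  atMost? : ∀ n vs i α β → Dec (AtMost n vs i α β)
  atMost? n vs i α β = reduced? i α β →-dec (kernelSize (monic i α β) vs ≤? n)

  Certificate : ℕ → List Carrierᴹ → Set (c ⊔ ℓ)
  Certificate n vs =
    (¬ θ ≈ 0# × ∀ i → UnitOrRadical i) × (All Normalised vs × AllPairs Separated vs) ×
    (∀ i α β → AtMost n vs i (element α) (element β))

  certificate? : ∀ n → Unary.Decidable (Certificate n)
  certificate? n vs =
    (¬? (θ ≟ 0#) ×-dec all? unitOrRadical?) ×-dec
    (All.all? normalised? vs ×-dec allPairs? separated? vs) ×-dec
    all? λ i → all? λ α → all? λ β → atMost? n vs i (element α) (element β)

  -- A point on a line has its generator on that line, hence in the kernel of the reduced row found
  -- for the line; the certificate bounds the number of generators there.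
  arc : ∀ {n} vs → Certificate n vs → ProjectiveArc (PHG₂ R) (length vs) n
  arc {n} vs ((θ≉0 , units) , (normalised , separated) , atMost) = (λ j → point (normal j)) , record
    -- Equal points include each other, and the inclusion to refute is the one placing the later
    -- vector in the span of the earlier.
    { distinct = λ {i} {j} (Kᵢ⊆Kⱼ , Kⱼ⊆Kᵢ) → allPairs⇒lookup-injective separated i j
        (λ sep → ⊥-elim (separated⇒∉span (normal i) sep (Kⱼ⊆Kᵢ (v∈span _))))
        (λ sep → ⊥-elim (separated⇒∉span (normal j) sep (Kᵢ⊆Kⱼ (v∈span _))))
    ; atMost   = λ (U , free) s s⊆L →
        let i , α , β , red , U⊆ker = line⊆reduced-kernel θ (unit? units) θ≉0 free in
        ≤-trans
          (∣s∣≤∣filter∣ (λ v → (monic i α β · v) ≟ 0#) vs s (λ j∈s → U⊆ker (s⊆L j∈s (v∈span _))))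
          -- The certificate speaks of enumerated entries, so it is applied at the indices of α and
          -- β and carried back.
          (≡.subst₂ (AtMost n vs i) (element-index α) (element-index β) (atMost i (index α) (index β)) red)
    }
    where
    normal : ∀ j → Normalised (lookup vs j)
    normal j = All.lookup normalised (∈-lookup j)

  -- The three hexadecimal digits of m are the indices of the coordinates.
  vector : ℕ → Carrierᴹ
  vector m = digit (m / 256) , digit (m / 16) , digit m
    where
    digit : ℕ → Carrier
    digit d = element (d mod 16)

-- The three rings with their enumerations and radicals.

-- The hexadecimal digit 4a + b stands for a + bX.
module 𝔾 = Search 𝔾₄ *↔× (×-decidable Fin._≟_ Fin._≟_) (2F , 0F)

𝔽₄-enumeration : Fin 4 ↔ 𝔽₄.Carrier
𝔽₄-enumeration = ↔-trans *↔× (2↔Bool ×-↔ 2↔Bool)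

-- The hexadecimal digit 8a + 4b + 2c + d stands for (a + bω) + (c + dω)X,
-- where ω is the class generating 𝔽₄ over 𝔽₂.
𝔽₄²-enumeration : Fin 16 ↔ (𝔽₄.Carrier × 𝔽₄.Carrier)
𝔽₄²-enumeration = ↔-trans *↔× (𝔽₄-enumeration ×-↔ 𝔽₄-enumeration)

_≟-𝔽₄_ : Decidable 𝔽₄._≈_
_≟-𝔽₄_ = ×-decidable Bool._≟_ Bool._≟_

-- Here θ is the class of X, which generates the radical of `𝕊₄` and likewise of `𝕋₄`; over `𝔾₄` it
-- is 2.
module 𝕊 = Search 𝕊₄ 𝔽₄²-enumeration (×-decidable _≟-𝔽₄_ _≟-𝔽₄_) (𝔽₄.0# , 𝔽₄.1#)

module 𝕋 = Search 𝕋₄ 𝔽₄²-enumeration (×-decidable _≟-𝔽₄_ _≟-𝔽₄_) (𝔽₄.0# , 𝔽₄.1#)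

-- The six arcs.

-- A fixed point, then orbits of five points, of (x , y , z) ↦ (x , - z , y - az)
-- with a = 2 + 3X over 𝔾₄ and a = ω over 𝕊₄ and 𝕋₄.
𝔾-166 : List ℕ
𝔾-166 =
  0x400 ∷
  0x403 ∷ 0x417 ∷ 0x4dd ∷ 0x471 ∷ 0x430 ∷ 0x405 ∷ 0x4f6 ∷ 0x4ee ∷ 0x46f ∷ 0x450 ∷
  0x409 ∷ 0x4bf ∷ 0x455 ∷ 0x4fb ∷ 0x490 ∷ 0x40a ∷ 0x4a8 ∷ 0x488 ∷ 0x48a ∷ 0x4a0 ∷
  0x40c ∷ 0x44b ∷ 0x499 ∷ 0x4b4 ∷ 0x4c0 ∷ 0x40d ∷ 0x474 ∷ 0x4cc ∷ 0x447 ∷ 0x4d0 ∷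
  0x40e ∷ 0x461 ∷ 0x433 ∷ 0x416 ∷ 0x4e0 ∷ 0x413 ∷ 0x414 ∷ 0x4ca ∷ 0x4a4 ∷ 0x4c3 ∷
  0x415 ∷ 0x4f7 ∷ 0x4db ∷ 0x492 ∷ 0x423 ∷ 0x41b ∷ 0x496 ∷ 0x4e8 ∷ 0x48c ∷ 0x443 ∷
  0x421 ∷ 0x43f ∷ 0x45d ∷ 0x479 ∷ 0x4b2 ∷ 0x424 ∷ 0x4cb ∷ 0x491 ∷ 0x436 ∷ 0x4e2 ∷
  0x426 ∷ 0x4e1 ∷ 0x43b ∷ 0x494 ∷ 0x4c2 ∷ 0x42d ∷ 0x476 ∷ 0x4e6 ∷ 0x4ed ∷ 0x472 ∷
  0x42f ∷ 0x45c ∷ 0x44c ∷ 0x44f ∷ 0x452 ∷ 0x435 ∷ 0x4f5 ∷ 0x4f1 ∷ 0x438 ∷ 0x481 ∷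
  0x437 ∷ 0x4df ∷ 0x45b ∷ 0x49a ∷ 0x4a1 ∷ 0x439 ∷ 0x4be ∷ 0x468 ∷ 0x484 ∷ 0x4c1 ∷
  0x43a ∷ 0x4ab ∷ 0x49f ∷ 0x457 ∷ 0x4d1 ∷ 0x446 ∷ 0x4e7 ∷ 0x4da ∷ 0x4a5 ∷ 0x4fc ∷
  0x454 ∷ 0x4ce ∷ 0x46d ∷ 0x47a ∷ 0x4af ∷ 0x456 ∷ 0x4e4 ∷ 0x4c7 ∷ 0x4d8 ∷ 0x48f ∷
  0x458 ∷ 0x487 ∷ 0x4d4 ∷ 0x4c6 ∷ 0x4ef ∷ 0x46a ∷ 0x4ae ∷ 0x46b ∷ 0x49b ∷ 0x49e ∷
  -- From `0x041` on, the first coordinate is in the radical (digits 0, 2, 8, a), and the coordinate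
  -- 1, digit 4, is the second or third. Over the other two rings the radical has digits 0 to 3, and
  -- 1 is digit 8.
  0x489 ∷ 0x4b7 ∷ 0x4d7 ∷ 0x4d9 ∷ 0x4b8 ∷ 0x041 ∷ 0x04c ∷ 0x04f ∷ 0x04a ∷ 0x0a4 ∷
  0x043 ∷ 0x046 ∷ 0x045 ∷ 0x048 ∷ 0x084 ∷ 0x240 ∷ 0x204 ∷ 0x24b ∷ 0x844 ∷ 0x847 ∷
  0x242 ∷ 0x224 ∷ 0x249 ∷ 0x84e ∷ 0x84d ∷ 0x244 ∷ 0x247 ∷ 0xa40 ∷ 0xa04 ∷ 0xa4b ∷
  0x24d ∷ 0xa42 ∷ 0xa24 ∷ 0xa49 ∷ 0x24e ∷ 0x840 ∷ 0x804 ∷ 0x84b ∷ 0xa44 ∷ 0xa47 ∷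
  0x842 ∷ 0x824 ∷ 0x849 ∷ 0xa4e ∷ 0xa4d ∷ []

-- Proved by evaluation: the list has length 166, its 13695 pairs are separated, and no reduced row
-- kills more than 11 of its vectors. The other five arcs are obtained in the same way.
𝔾-arc-166 : ProjectiveArc (PHG₂ 𝔾₄) 166 11
𝔾-arc-166 = 𝔾.arc (map 𝔾.vector 𝔾-166) (from-yes (𝔾.certificate? 11 (map 𝔾.vector 𝔾-166)))

𝔾-186 : List ℕ
𝔾-186 =
  0x400 ∷
  0x401 ∷ 0x43d ∷ 0x477 ∷ 0x4d3 ∷ 0x410 ∷ 0x402 ∷ 0x42a ∷ 0x4aa ∷ 0x4a2 ∷ 0x420 ∷
  0x405 ∷ 0x4f6 ∷ 0x4ee ∷ 0x46f ∷ 0x450 ∷ 0x407 ∷ 0x4dc ∷ 0x444 ∷ 0x4cd ∷ 0x470 ∷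
  0x40b ∷ 0x495 ∷ 0x4ff ∷ 0x459 ∷ 0x4b0 ∷ 0x40c ∷ 0x44b ∷ 0x499 ∷ 0x4b4 ∷ 0x4c0 ∷
  0x40d ∷ 0x474 ∷ 0x4cc ∷ 0x447 ∷ 0x4d0 ∷ 0x40e ∷ 0x461 ∷ 0x433 ∷ 0x416 ∷ 0x4e0 ∷
  0x40f ∷ 0x45e ∷ 0x466 ∷ 0x4e5 ∷ 0x4f0 ∷ 0x412 ∷ 0x42b ∷ 0x497 ∷ 0x4d5 ∷ 0x4f3 ∷
  0x413 ∷ 0x414 ∷ 0x4ca ∷ 0x4a4 ∷ 0x4c3 ∷ 0x418 ∷ 0x483 ∷ 0x41f ∷ 0x45f ∷ 0x453 ∷
  0x419 ∷ 0x4bc ∷ 0x442 ∷ 0x42e ∷ 0x463 ∷ 0x41a ∷ 0x4a9 ∷ 0x4b5 ∷ 0x4fd ∷ 0x473 ∷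
  0x41c ∷ 0x448 ∷ 0x486 ∷ 0x4eb ∷ 0x493 ∷ 0x41d ∷ 0x475 ∷ 0x4f9 ∷ 0x4ba ∷ 0x4a3 ∷
  0x41e ∷ 0x462 ∷ 0x42c ∷ 0x449 ∷ 0x4b3 ∷ 0x421 ∷ 0x43f ∷ 0x45d ∷ 0x479 ∷ 0x4b2 ∷
  0x439 ∷ 0x4be ∷ 0x468 ∷ 0x484 ∷ 0x4c1 ∷ 0x445 ∷ 0x4fa ∷ 0x4a7 ∷ 0x4d6 ∷ 0x4ec ∷
  0x446 ∷ 0x4e7 ∷ 0x4da ∷ 0x4a5 ∷ 0x4fc ∷ 0x44d ∷ 0x478 ∷ 0x485 ∷ 0x4fe ∷ 0x46c ∷
  0x44e ∷ 0x465 ∷ 0x4f8 ∷ 0x48d ∷ 0x47c ∷ 0x454 ∷ 0x4ce ∷ 0x46d ∷ 0x47a ∷ 0x4af ∷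
  0x456 ∷ 0x4e4 ∷ 0x4c7 ∷ 0x4d8 ∷ 0x48f ∷ 0x458 ∷ 0x487 ∷ 0x4d4 ∷ 0x4c6 ∷ 0x4ef ∷
  0x45a ∷ 0x4ad ∷ 0x47e ∷ 0x464 ∷ 0x4cf ∷ 0x489 ∷ 0x4b7 ∷ 0x4d7 ∷ 0x4d9 ∷ 0x4b8 ∷
  0x4a6 ∷ 0x4e9 ∷ 0x4b9 ∷ 0x4b6 ∷ 0x4ea ∷ 0x042 ∷ 0x024 ∷ 0x049 ∷ 0x04e ∷ 0x04d ∷
  0x043 ∷ 0x046 ∷ 0x045 ∷ 0x048 ∷ 0x084 ∷ 0x242 ∷ 0x224 ∷ 0x249 ∷ 0x84e ∷ 0x84d ∷
  0x243 ∷ 0x846 ∷ 0x845 ∷ 0x248 ∷ 0x284 ∷ 0x244 ∷ 0x247 ∷ 0xa40 ∷ 0xa04 ∷ 0xa4b ∷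
  0x24c ∷ 0x24f ∷ 0xa4a ∷ 0xaa4 ∷ 0xa41 ∷ 0x840 ∷ 0x804 ∷ 0x84b ∷ 0xa44 ∷ 0xa47 ∷
  0x841 ∷ 0xa4c ∷ 0xa4f ∷ 0x84a ∷ 0x8a4 ∷ []

𝔾-arc-186 : ProjectiveArc (PHG₂ 𝔾₄) 186 12
𝔾-arc-186 = 𝔾.arc (map 𝔾.vector 𝔾-186) (from-yes (𝔾.certificate? 12 (map 𝔾.vector 𝔾-186)))

𝕊-166 : List ℕ
𝕊-166 =
  0x800 ∷
  0x801 ∷ 0x813 ∷ 0x833 ∷ 0x831 ∷ 0x810 ∷ 0x808 ∷ 0x884 ∷ 0x844 ∷ 0x848 ∷ 0x880 ∷
  0x80a ∷ 0x8a5 ∷ 0x855 ∷ 0x85a ∷ 0x8a0 ∷ 0x80b ∷ 0x8b6 ∷ 0x866 ∷ 0x86b ∷ 0x8b0 ∷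
  0x804 ∷ 0x84c ∷ 0x8cc ∷ 0x8c4 ∷ 0x840 ∷ 0x805 ∷ 0x85f ∷ 0x8ff ∷ 0x8f5 ∷ 0x850 ∷
  0x807 ∷ 0x87e ∷ 0x8ee ∷ 0x8e7 ∷ 0x870 ∷ 0x80c ∷ 0x8c8 ∷ 0x888 ∷ 0x88c ∷ 0x8c0 ∷
  0x80f ∷ 0x8fa ∷ 0x8aa ∷ 0x8af ∷ 0x8f0 ∷ 0x82b ∷ 0x8b4 ∷ 0x847 ∷ 0x87a ∷ 0x8a2 ∷
  0x826 ∷ 0x86f ∷ 0x8fc ∷ 0x8c7 ∷ 0x872 ∷ 0x82e ∷ 0x8eb ∷ 0x8b8 ∷ 0x88f ∷ 0x8f2 ∷
  0x82f ∷ 0x8f8 ∷ 0x88b ∷ 0x8be ∷ 0x8e2 ∷ 0x818 ∷ 0x885 ∷ 0x857 ∷ 0x87b ∷ 0x8b1 ∷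
  0x815 ∷ 0x85e ∷ 0x8ec ∷ 0x8c6 ∷ 0x861 ∷ 0x81e ∷ 0x8e8 ∷ 0x88a ∷ 0x8ad ∷ 0x8d1 ∷
  0x81f ∷ 0x8fb ∷ 0x8b9 ∷ 0x89c ∷ 0x8c1 ∷ 0x838 ∷ 0x887 ∷ 0x876 ∷ 0x86a ∷ 0x8a3 ∷
  0x83a ∷ 0x8a6 ∷ 0x867 ∷ 0x878 ∷ 0x883 ∷ 0x83b ∷ 0x8b5 ∷ 0x854 ∷ 0x849 ∷ 0x893 ∷
  0x834 ∷ 0x84f ∷ 0x8fe ∷ 0x8e6 ∷ 0x863 ∷ 0x836 ∷ 0x86e ∷ 0x8ef ∷ 0x8f4 ∷ 0x843 ∷
  0x835 ∷ 0x85c ∷ 0x8cd ∷ 0x8d7 ∷ 0x873 ∷ 0x83c ∷ 0x8cb ∷ 0x8ba ∷ 0x8ae ∷ 0x8e3 ∷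
  0x83e ∷ 0x8ea ∷ 0x8ab ∷ 0x8bc ∷ 0x8c3 ∷ 0x081 ∷ 0x018 ∷ 0x085 ∷ 0x08b ∷ 0x08f ∷
  0x083 ∷ 0x038 ∷ 0x087 ∷ 0x08a ∷ 0x08e ∷ 0x281 ∷ 0x218 ∷ 0x285 ∷ 0x38b ∷ 0x38f ∷
  0x283 ∷ 0x238 ∷ 0x287 ∷ 0x38a ∷ 0x38e ∷ 0x28a ∷ 0x28e ∷ 0x183 ∷ 0x138 ∷ 0x187 ∷
  0x28b ∷ 0x28f ∷ 0x181 ∷ 0x118 ∷ 0x185 ∷ 0x188 ∷ 0x18c ∷ 0x380 ∷ 0x308 ∷ 0x384 ∷
  0x189 ∷ 0x18d ∷ 0x382 ∷ 0x328 ∷ 0x386 ∷ []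

𝕊-arc-166 : ProjectiveArc (PHG₂ 𝕊₄) 166 11
𝕊-arc-166 = 𝕊.arc (map 𝕊.vector 𝕊-166) (from-yes (𝕊.certificate? 11 (map 𝕊.vector 𝕊-166)))

𝕊-186 : List ℕ
𝕊-186 =
  0x800 ∷
  0x801 ∷ 0x813 ∷ 0x833 ∷ 0x831 ∷ 0x810 ∷ 0x806 ∷ 0x86d ∷ 0x8dd ∷ 0x8d6 ∷ 0x860 ∷
  0x805 ∷ 0x85f ∷ 0x8ff ∷ 0x8f5 ∷ 0x850 ∷ 0x807 ∷ 0x87e ∷ 0x8ee ∷ 0x8e7 ∷ 0x870 ∷
  0x80e ∷ 0x8e9 ∷ 0x899 ∷ 0x89e ∷ 0x8e0 ∷ 0x80d ∷ 0x8db ∷ 0x8bb ∷ 0x8bd ∷ 0x8d0 ∷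
  0x80f ∷ 0x8fa ∷ 0x8aa ∷ 0x8af ∷ 0x8f0 ∷ 0x828 ∷ 0x886 ∷ 0x865 ∷ 0x859 ∷ 0x892 ∷
  0x82a ∷ 0x8a7 ∷ 0x874 ∷ 0x84b ∷ 0x8b2 ∷ 0x829 ∷ 0x895 ∷ 0x856 ∷ 0x868 ∷ 0x882 ∷
  0x82b ∷ 0x8b4 ∷ 0x847 ∷ 0x87a ∷ 0x8a2 ∷ 0x824 ∷ 0x84e ∷ 0x8ed ∷ 0x8d5 ∷ 0x852 ∷
  0x826 ∷ 0x86f ∷ 0x8fc ∷ 0x8c7 ∷ 0x872 ∷ 0x825 ∷ 0x85d ∷ 0x8de ∷ 0x8e4 ∷ 0x842 ∷
  0x827 ∷ 0x87c ∷ 0x8cf ∷ 0x8f6 ∷ 0x862 ∷ 0x82c ∷ 0x8ca ∷ 0x8a9 ∷ 0x89d ∷ 0x8d2 ∷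
  0x82e ∷ 0x8eb ∷ 0x8b8 ∷ 0x88f ∷ 0x8f2 ∷ 0x82d ∷ 0x8d9 ∷ 0x89a ∷ 0x8ac ∷ 0x8c2 ∷
  0x82f ∷ 0x8f8 ∷ 0x88b ∷ 0x8be ∷ 0x8e2 ∷ 0x818 ∷ 0x885 ∷ 0x857 ∷ 0x87b ∷ 0x8b1 ∷
  0x81a ∷ 0x8a4 ∷ 0x846 ∷ 0x869 ∷ 0x891 ∷ 0x819 ∷ 0x896 ∷ 0x864 ∷ 0x84a ∷ 0x8a1 ∷
  0x814 ∷ 0x84d ∷ 0x8df ∷ 0x8f7 ∷ 0x871 ∷ 0x815 ∷ 0x85e ∷ 0x8ec ∷ 0x8c6 ∷ 0x861 ∷
  0x817 ∷ 0x87f ∷ 0x8fd ∷ 0x8d4 ∷ 0x841 ∷ 0x83a ∷ 0x8a6 ∷ 0x867 ∷ 0x878 ∷ 0x883 ∷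
  0x839 ∷ 0x894 ∷ 0x845 ∷ 0x85b ∷ 0x8b3 ∷ 0x83b ∷ 0x8b5 ∷ 0x854 ∷ 0x849 ∷ 0x893 ∷
  0x83c ∷ 0x8cb ∷ 0x8ba ∷ 0x8ae ∷ 0x8e3 ∷ 0x83e ∷ 0x8ea ∷ 0x8ab ∷ 0x8bc ∷ 0x8c3 ∷
  0x83f ∷ 0x8f9 ∷ 0x898 ∷ 0x88d ∷ 0x8d3 ∷ 0x081 ∷ 0x018 ∷ 0x085 ∷ 0x08b ∷ 0x08f ∷
  0x083 ∷ 0x038 ∷ 0x087 ∷ 0x08a ∷ 0x08e ∷ 0x281 ∷ 0x218 ∷ 0x285 ∷ 0x38b ∷ 0x38f ∷
  0x283 ∷ 0x238 ∷ 0x287 ∷ 0x38a ∷ 0x38e ∷ 0x28a ∷ 0x28e ∷ 0x183 ∷ 0x138 ∷ 0x187 ∷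
  0x28b ∷ 0x28f ∷ 0x181 ∷ 0x118 ∷ 0x185 ∷ []

𝕊-arc-186 : ProjectiveArc (PHG₂ 𝕊₄) 186 12
𝕊-arc-186 = 𝕊.arc (map 𝕊.vector 𝕊-186) (from-yes (𝕊.certificate? 12 (map 𝕊.vector 𝕊-186)))

𝕋-166 : List ℕ
𝕋-166 =
  0x800 ∷
  0x803 ∷ 0x832 ∷ 0x822 ∷ 0x823 ∷ 0x830 ∷ 0x80a ∷ 0x8a5 ∷ 0x855 ∷ 0x85a ∷ 0x8a0 ∷
  0x809 ∷ 0x897 ∷ 0x877 ∷ 0x879 ∷ 0x890 ∷ 0x80b ∷ 0x8b6 ∷ 0x866 ∷ 0x86b ∷ 0x8b0 ∷
  0x804 ∷ 0x84c ∷ 0x8cc ∷ 0x8c4 ∷ 0x840 ∷ 0x805 ∷ 0x85f ∷ 0x8ff ∷ 0x8f5 ∷ 0x850 ∷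
  0x807 ∷ 0x87e ∷ 0x8ee ∷ 0x8e7 ∷ 0x870 ∷ 0x80e ∷ 0x8e9 ∷ 0x899 ∷ 0x89e ∷ 0x8e0 ∷
  0x80f ∷ 0x8fa ∷ 0x8aa ∷ 0x8af ∷ 0x8f0 ∷ 0x828 ∷ 0x886 ∷ 0x865 ∷ 0x859 ∷ 0x892 ∷
  0x82a ∷ 0x8a7 ∷ 0x874 ∷ 0x84b ∷ 0x8b2 ∷ 0x82b ∷ 0x8b4 ∷ 0x847 ∷ 0x87a ∷ 0x8a2 ∷
  0x827 ∷ 0x87c ∷ 0x8cf ∷ 0x8f6 ∷ 0x862 ∷ 0x82e ∷ 0x8eb ∷ 0x8b8 ∷ 0x88f ∷ 0x8f2 ∷
  0x82d ∷ 0x8d9 ∷ 0x89a ∷ 0x8ac ∷ 0x8c2 ∷ 0x81a ∷ 0x8a4 ∷ 0x846 ∷ 0x869 ∷ 0x891 ∷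
  0x815 ∷ 0x85e ∷ 0x8ec ∷ 0x8c6 ∷ 0x861 ∷ 0x81c ∷ 0x8c9 ∷ 0x89b ∷ 0x8bf ∷ 0x8f1 ∷
  0x81f ∷ 0x8fb ∷ 0x8b9 ∷ 0x89c ∷ 0x8c1 ∷ 0x839 ∷ 0x894 ∷ 0x845 ∷ 0x85b ∷ 0x8b3 ∷
  0x834 ∷ 0x84f ∷ 0x8fe ∷ 0x8e6 ∷ 0x863 ∷ 0x836 ∷ 0x86e ∷ 0x8ef ∷ 0x8f4 ∷ 0x843 ∷
  0x837 ∷ 0x87d ∷ 0x8dc ∷ 0x8c5 ∷ 0x853 ∷ 0x83c ∷ 0x8cb ∷ 0x8ba ∷ 0x8ae ∷ 0x8e3 ∷
  0x83e ∷ 0x8ea ∷ 0x8ab ∷ 0x8bc ∷ 0x8c3 ∷ 0x081 ∷ 0x018 ∷ 0x085 ∷ 0x089 ∷ 0x08d ∷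
  0x083 ∷ 0x038 ∷ 0x087 ∷ 0x08b ∷ 0x08f ∷ 0x281 ∷ 0x218 ∷ 0x285 ∷ 0x189 ∷ 0x18d ∷
  0x283 ∷ 0x238 ∷ 0x287 ∷ 0x18b ∷ 0x18f ∷ 0x288 ∷ 0x28c ∷ 0x380 ∷ 0x308 ∷ 0x384 ∷
  0x28a ∷ 0x28e ∷ 0x382 ∷ 0x328 ∷ 0x386 ∷ 0x181 ∷ 0x118 ∷ 0x185 ∷ 0x389 ∷ 0x38d ∷
  0x183 ∷ 0x138 ∷ 0x187 ∷ 0x38b ∷ 0x38f ∷ []

𝕋-arc-166 : ProjectiveArc (PHG₂ 𝕋₄) 166 11
𝕋-arc-166 = 𝕋.arc (map 𝕋.vector 𝕋-166) (from-yes (𝕋.certificate? 11 (map 𝕋.vector 𝕋-166)))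

𝕋-186 : List ℕ
𝕋-186 =
  0x800 ∷
  0x803 ∷ 0x832 ∷ 0x822 ∷ 0x823 ∷ 0x830 ∷ 0x806 ∷ 0x86d ∷ 0x8dd ∷ 0x8d6 ∷ 0x860 ∷
  0x805 ∷ 0x85f ∷ 0x8ff ∷ 0x8f5 ∷ 0x850 ∷ 0x80d ∷ 0x8db ∷ 0x8bb ∷ 0x8bd ∷ 0x8d0 ∷
  0x80f ∷ 0x8fa ∷ 0x8aa ∷ 0x8af ∷ 0x8f0 ∷ 0x828 ∷ 0x886 ∷ 0x865 ∷ 0x859 ∷ 0x892 ∷
  0x82a ∷ 0x8a7 ∷ 0x874 ∷ 0x84b ∷ 0x8b2 ∷ 0x829 ∷ 0x895 ∷ 0x856 ∷ 0x868 ∷ 0x882 ∷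
  0x82b ∷ 0x8b4 ∷ 0x847 ∷ 0x87a ∷ 0x8a2 ∷ 0x826 ∷ 0x86f ∷ 0x8fc ∷ 0x8c7 ∷ 0x872 ∷
  0x825 ∷ 0x85d ∷ 0x8de ∷ 0x8e4 ∷ 0x842 ∷ 0x82d ∷ 0x8d9 ∷ 0x89a ∷ 0x8ac ∷ 0x8c2 ∷
  0x82f ∷ 0x8f8 ∷ 0x88b ∷ 0x8be ∷ 0x8e2 ∷ 0x818 ∷ 0x885 ∷ 0x857 ∷ 0x87b ∷ 0x8b1 ∷
  0x81a ∷ 0x8a4 ∷ 0x846 ∷ 0x869 ∷ 0x891 ∷ 0x819 ∷ 0x896 ∷ 0x864 ∷ 0x84a ∷ 0x8a1 ∷
  0x81b ∷ 0x8b7 ∷ 0x875 ∷ 0x858 ∷ 0x881 ∷ 0x814 ∷ 0x84d ∷ 0x8df ∷ 0x8f7 ∷ 0x871 ∷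
  0x817 ∷ 0x87f ∷ 0x8fd ∷ 0x8d4 ∷ 0x841 ∷ 0x81d ∷ 0x8da ∷ 0x8a8 ∷ 0x88e ∷ 0x8e1 ∷
  0x81f ∷ 0x8fb ∷ 0x8b9 ∷ 0x89c ∷ 0x8c1 ∷ 0x838 ∷ 0x887 ∷ 0x876 ∷ 0x86a ∷ 0x8a3 ∷
  0x83a ∷ 0x8a6 ∷ 0x867 ∷ 0x878 ∷ 0x883 ∷ 0x839 ∷ 0x894 ∷ 0x845 ∷ 0x85b ∷ 0x8b3 ∷
  0x83b ∷ 0x8b5 ∷ 0x854 ∷ 0x849 ∷ 0x893 ∷ 0x834 ∷ 0x84f ∷ 0x8fe ∷ 0x8e6 ∷ 0x863 ∷
  0x837 ∷ 0x87d ∷ 0x8dc ∷ 0x8c5 ∷ 0x853 ∷ 0x83d ∷ 0x8d8 ∷ 0x889 ∷ 0x89f ∷ 0x8f3 ∷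
  0x83f ∷ 0x8f9 ∷ 0x898 ∷ 0x88d ∷ 0x8d3 ∷ 0x082 ∷ 0x028 ∷ 0x086 ∷ 0x08a ∷ 0x08e ∷
  0x083 ∷ 0x038 ∷ 0x087 ∷ 0x08b ∷ 0x08f ∷ 0x280 ∷ 0x208 ∷ 0x284 ∷ 0x188 ∷ 0x18c ∷
  0x281 ∷ 0x218 ∷ 0x285 ∷ 0x189 ∷ 0x18d ∷ 0x28a ∷ 0x28e ∷ 0x382 ∷ 0x328 ∷ 0x386 ∷
  0x28b ∷ 0x28f ∷ 0x383 ∷ 0x338 ∷ 0x387 ∷ 0x180 ∷ 0x108 ∷ 0x184 ∷ 0x388 ∷ 0x38c ∷
  0x181 ∷ 0x118 ∷ 0x185 ∷ 0x389 ∷ 0x38d ∷ []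

𝕋-arc-186 : ProjectiveArc (PHG₂ 𝕋₄) 186 12
𝕋-arc-186 = 𝕋.arc (map 𝕋.vector 𝕋-186) (from-yes (𝕋.certificate? 12 (map 𝕋.vector 𝕋-186)))

theorem3p7 : ∀ (R : Ring 0ℓ 0ℓ) → R ≡ 𝔾₄ ⊎ R ≡ 𝕊₄ ⊎ R ≡ 𝕋₄ →
    ProjectiveArc (PHG₂ R) 166 11 × ProjectiveArc (PHG₂ R) 186 12
theorem3p7 R (inj₁ ≡.refl)        = 𝔾-arc-166 , 𝔾-arc-186
theorem3p7 R (inj₂ (inj₁ ≡.refl)) = 𝕊-arc-166 , 𝕊-arc-186
theorem3p7 R (inj₂ (inj₂ ≡.refl)) = 𝕋-arc-166 , 𝕋-arc-186
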